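{- Let $n,g,k,t$ be positive integers with $t\le k$. If there exist an orthogonal array OA$(t,k,g)$ and a large set with multiplicity LS$(t,k,n;g^{k-t})$, then there exists a large set of H-designs LH$(n,g,k,t)$.
   Context: A Steiner system S$(t,k,n)$ is a pair $(Q,B)$ where $Q$ is an $n$-set and $B$ is a collection of $k$-subsets (blocks) of $Q$ such that every $t$-subset of $Q$ is contained in exactly one block. A large set with multiplicity $\mu$, LS$(t,k,n;\mu)$, is a family (the same system may occur more than once) of Steiner systems S$(t,k,n)$ on a common $n$-set $Q$ such that every $k$-subset of $Q$ is a block of exactly $\mu$ of the systems. An orthogonal array OA$(t,k,g)$ is a $g^t\times k$ matrix with entries from $\mathbb{Z}_g$ such that in the submatrix formed by any $t$ columns each ordered $t$-tuple over $\mathbb{Z}_g$ occurs exactly once as a row. An H-design H$(n,g,k,t)$ is a triple $(Q,G,B)$ where $Q$ is a set of $ng$ points, $G$ is a partition of $Q$ into $n$ groups of size $g$, and $B$ is a set of $k$-subsets of $Q$ (blocks) such that each block meets each group in at most one point and any $t$ points from $t$ distinct groups lie in exactly one block. A large set of H-designs LH$(n,g,k,t)$ is a partition of the set of all $k$-subsets of $Q$ meeting each group in at most one point into pairwise disjoint block sets, each forming an H-design H$(n,g,k,t)$ with the same $Q$ and $G$. -}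

module Defs where

open import Level using (0ℓ)
open import Data.Nat using (ℕ; _*_; _^_; _≤_)
open import Data.Fin using (Fin)
open import Data.Fin.Subset using (Subset; _∈_; _⊆_; _∩_; ∣_∣)
open import Data.List using (length; filter; allFin)
open import Data.Product using (∃!; _×_)
open import Data.Vec.Functional using (Vector)
open import Function.Definitions using (Injective)
open import Relation.Binary.PropositionalEquality using (_≡_)
open import Relation.Unary using (Pred; Decidable; Satisfiable)

-- An n-set is represented by Fin n.  A collection of blocks is a decidable
-- predicate on subsets; decidability (automatic classically) is what allows
-- the systems containing a given block to be counted.

record SteinerSystem (t k n : ℕ) : Set₁ where
  field
    Block      : Pred (Subset n) 0ℓ
    block?     : Decidable Block
    block-size : ∀ {X} → Block X → ∣ X ∣ ≡ k
    covers     : ∀ (T : Subset n) → ∣ T ∣ ≡ t →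
                 ∃! _≡_ (λ X → Block X × T ⊆ X)

-- Repetitions in the family are allowed: `system` need not be injective.
record LS (t k n μ : ℕ) : Set₁ where
  field
    count  : ℕ
    system : Fin count → SteinerSystem t k n

  open SteinerSystem using (block?)

  field
    multiplicity : ∀ (X : Subset n) → ∣ X ∣ ≡ k →
                   length (filter (λ i → block? (system i) X) (allFin count)) ≡ μ

-- ℤ_g enters only as a g-element alphabet, so its elements are taken from
-- Fin g.  A choice of t columns is an injection Fin t → Fin k.
record OA (t k g : ℕ) : Set where
  field
    matrix     : Vector (Vector (Fin g) k) (g ^ t)
    orthogonal : ∀ (column : Fin t → Fin k) → Injective _≡_ _≡_ column →
                 ∀ (u : Vector (Fin g) t) →
                 ∃! _≡_ (λ r → ∀ j → matrix r (column j) ≡ u j)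

record Grouping (n g : ℕ) : Set where
  field
    group      : Fin n → Subset (n * g)
    partition  : ∀ x → ∃! _≡_ (λ i → x ∈ group i)
    group-size : ∀ i → ∣ group i ∣ ≡ g

module _ {n g : ℕ} (G : Grouping n g) where
  open Grouping G

  Transversal : Pred (Subset (n * g)) 0ℓ
  Transversal X = ∀ i → ∣ X ∩ group i ∣ ≤ 1

  -- A set of t points from t distinct groups is a transversal set of size t.
  record HDesign (k t : ℕ) : Set₁ where
    field
      Block             : Pred (Subset (n * g)) 0ℓ
      block?            : Decidable Block
      block-size        : ∀ {X} → Block X → ∣ X ∣ ≡ k
      block-transversal : ∀ {X} → Block X → Transversal X
      covers            : ∀ (T : Subset (n * g)) → ∣ T ∣ ≡ t → Transversal T →
                          ∃! _≡_ (λ X → Block X × T ⊆ X)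

-- Blocks are transversal k-subsets by definition, so `partition` gives both
-- covering and pairwise disjointness; `nonempty` excludes empty parts.
record LH (n g k t : ℕ) : Set₁ where
  field
    grouping : Grouping n g
    count    : ℕ
    design   : Fin count → HDesign grouping k t

  open HDesign using (Block)

  field
    nonempty  : ∀ i → Satisfiable (Block (design i))
    partition : ∀ (X : Subset (n * g)) → ∣ X ∣ ≡ k → Transversal grouping X →
                ∃! _≡_ (λ i → Block (design i) X)

{-# OPTIONS --safe #-}

-- Translating the array by a constant on the last k - t columns gives g^(k-t)
-- arrays that partition all words of length k.  Every k-subset X of the n-set
-- lies in exactly g^(k-t) of the systems, so these can be matched with the
-- translates.  The design built from a system S consists of the sets
-- {(x , w x) : x ∈ X}, where X is a block of S and w is a row of the translate
-- matched with S at X.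
module Submission where

open import Defs
open import Level using (0ℓ)
open import Data.Nat using (ℕ; zero; suc; _+_; _*_; _∸_; _^_; _≤_; _<_; _%_; NonZero)
open import Data.Nat.Properties as ℕ using (≡-irrelevant)
open import Data.Nat.DivMod using (_mod_; m%n%n≡m%n; %-distribˡ-+; [m+n]%n≡m%n; m<n⇒m%n≡m)
open import Data.Bool using (true; false)
open import Data.Bool.Properties as Bool using ()
open import Data.Fin using (Fin; zero; suc; toℕ; combine; quotient; remainder; inject≤; finToFun; funToFin; splitAt; _↑ˡ_; _↑ʳ_)
open import Data.Fin.Properties as Fin using (any?; injective⇒≤; combine-injective; combine-injectiveˡ; combine-injectiveʳ; combine-remQuot; toℕ-fromℕ<; toℕ-injective; toℕ<n; ↑ˡ-injective; inject≤-injective; finToFun-funToFin; funToFin-finToFin)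
open import Data.Fin.Subset using (Subset; _∈_; _⊆_; _∩_; ∣_∣)
open import Data.Fin.Subset.Properties using (anySubset?; ⊆-antisym; ⊆-reflexive; x∈p∩q⁺; x∈p∩q⁻)
open import Data.List as List using (List; length; filter; allFin)
open import Data.List.Membership.Propositional.Properties using (∈-lookup; ∈-filter⁺; ∈-filter⁻; ∈-allFin)
open import Data.List.Relation.Unary.All as All using ()
open import Data.List.Relation.Unary.AllPairs using (_∷_)
open import Data.List.Relation.Unary.Any as Any using ()
open import Data.List.Relation.Unary.Any.Properties using (lookup-index)
open import Data.List.Relation.Unary.Unique.Propositional using (Unique)
open import Data.List.Relation.Unary.Unique.Propositional.Properties using (filter⁺; allFin⁺)
open import Data.Product using (∃; ∃₂; ∃!; Σ; _×_; _,_; proj₁; proj₂)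
open import Data.Sum using (inj₁; inj₂)
open import Data.Vec as Vec using (_∷_; here; there)
open import Data.Vec.Functional using (_++_)
open import Data.Vec.Functional.Properties using (lookup-++ˡ; lookup-++ʳ)
open import Data.Vec.Properties as Vec using ([]=⇒lookup; lookup⇒[]=; lookup∘tabulate)
open import Function using (_∘_)
open import Function.Definitions using (Injective)
open import Relation.Binary.PropositionalEquality using (_≡_; _≗_; refl; sym; trans; cong; cong₂; subst; module ≡-Reasoning)
open import Relation.Nullary using (Dec; yes; no; does; contradiction)
open import Relation.Nullary.Decidable using (_×-dec_; map′; dec-true)
open import Relation.Unary using (Pred; Decidable; Satisfiable)

open Grouping using (group)

-- Counting a predicate by listing its elements.

record Enumeration {n} (P : Pred (Fin n) 0ℓ) (m : ℕ) : Set where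
  field
    at           : Fin m → Fin n
    at-injective : Injective _≡_ _≡_ at
    at-satisfies : ∀ j → P (at j)
    -- Proofs of `P x` may differ, but `at-injective` makes the index depend on `x` alone.
    index        : ∀ {x} → P x → ∃ λ j → at j ≡ x

open Enumeration

enumerateSubset : ∀ {n m} (X : Subset n) → ∣ X ∣ ≡ m → Enumeration (_∈ X) m
enumerateSubset X refl = record
  { at = elem X ; at-injective = elem-injective X ; at-satisfies = elem∈ X ; index = elem-index }
  where
  elem : ∀ {n} (X : Subset n) → Fin ∣ X ∣ → Fin n
  elem (true  ∷ X) zero    = zero
  elem (true  ∷ X) (suc j) = suc (elem X j)
  elem (false ∷ X) j       = suc (elem X j)

  elem-injective : ∀ {n} (X : Subset n) → Injective _≡_ _≡_ (elem X)
  elem-injective (true  ∷ X) {zero}  {zero}  _  = refl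
  elem-injective (true  ∷ X) {suc _} {suc _} eq = cong suc (elem-injective X (Fin.suc-injective eq))
  elem-injective (false ∷ X)                 eq = elem-injective X (Fin.suc-injective eq)

  elem∈ : ∀ {n} (X : Subset n) j → elem X j ∈ X
  elem∈ (true  ∷ X) zero    = here
  elem∈ (true  ∷ X) (suc j) = there (elem∈ X j)
  elem∈ (false ∷ X) j       = there (elem∈ X j)

  elem-index : ∀ {n} {X : Subset n} {x} → x ∈ X → ∃ λ j → elem X j ≡ x
  elem-index here = zero , refl
  elem-index {X = true ∷ X} (there x∈X) with elem-index x∈X
  ... | j , eq = suc j , cong suc eq
  elem-index {X = false ∷ X} (there x∈X) with elem-index x∈X
  ... | j , eq = j , cong suc eq

lookup-injective : ∀ {A : Set} {xs : List A} → Unique xs → Injective _≡_ _≡_ (List.lookup xs)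
lookup-injective (_ ∷ _)    {zero}  {zero}  _  = refl
lookup-injective (x∉xs ∷ _) {zero}  {suc j} eq = contradiction eq (All.lookup x∉xs (∈-lookup j))
lookup-injective (x∉xs ∷ _) {suc i} {zero}  eq = contradiction (sym eq) (All.lookup x∉xs (∈-lookup i))
lookup-injective (_ ∷ u)    {suc i} {suc j} eq = cong suc (lookup-injective u eq)

enumerateFilter : ∀ {n m} {P : Pred (Fin n) 0ℓ} (P? : Decidable P) →
                  length (filter P? (allFin n)) ≡ m → Enumeration P m
enumerateFilter {n} P? refl = record
  { at           = List.lookup (filter P? (allFin n))
  ; at-injective = lookup-injective (filter⁺ P? (allFin⁺ n))
  ; at-satisfies = λ j → proj₂ (∈-filter⁻ P? {xs = allFin n} (∈-lookup j))
  ; index        = λ {x} Px → let x∈ = ∈-filter⁺ P? (∈-allFin x) Px in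
                              Any.index x∈ , sym (lookup-index x∈)
  }

-- Images of maps and sets with at most one element.

opaque

  image : ∀ {m n} → (Fin m → Fin n) → Subset n
  image f = Vec.tabulate λ z → does (any? λ j → f j Fin.≟ z)

  ∈-image⁺ : ∀ {m n} {f : Fin m → Fin n} j → f j ∈ image f
  ∈-image⁺ {f = f} j = lookup⇒[]= _ _ (trans (lookup∘tabulate _ (f j)) (dec-true (any? _) (j , refl)))

  ∈-image⁻ : ∀ {m n} {f : Fin m → Fin n} {z} → z ∈ image f → ∃ λ j → f j ≡ z
  ∈-image⁻ {f = f} {z} z∈ with any? (λ j → f j Fin.≟ z) | trans (sym (lookup∘tabulate _ z)) ([]=⇒lookup z∈)
  ... | yes found | _ = found

module _ {m n} {f : Fin m → Fin n} where

  -- Injections in both directions: an element of the image goes to a chosen preimage, and `j` goes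
  -- to the place of `f j` in the enumeration. Only the second uses the injectivity of `f`.
  ∣image∣ : Injective _≡_ _≡_ f → ∣ image f ∣ ≡ m
  ∣image∣ inj = ℕ.≤-antisym
    (injective⇒≤ {f = λ j → proj₁ (∈-image⁻ (at-satisfies E j))}
      λ {i} {j} eq → at-injective E (trans (sym (proj₂ (∈-image⁻ (at-satisfies E i))))
                       (trans (cong f eq) (proj₂ (∈-image⁻ (at-satisfies E j))))))
    (injective⇒≤ {f = λ j → proj₁ (index E (∈-image⁺ j))}
      λ {i} {j} eq → inj (trans (sym (proj₂ (index E (∈-image⁺ i))))
                       (trans (cong (at E) eq) (proj₂ (index E (∈-image⁺ j))))))
    where E = enumerateSubset (image f) refl

∣X∣≤1⇒≡ : ∀ {n} {X : Subset n} {x y} → ∣ X ∣ ≤ 1 → x ∈ X → y ∈ X → x ≡ y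
∣X∣≤1⇒≡ {X = X} ∣X∣≤1 x∈X y∈X with index E x∈X | index E y∈X
  where E = enumerateSubset X refl
... | i , refl | j , refl =
  cong (at (enumerateSubset X refl)) (inject≤-injective ∣X∣≤1 ∣X∣≤1 i j (Fin1-≡ _ _))
  where
  Fin1-≡ : (i j : Fin 1) → i ≡ j
  Fin1-≡ zero zero = refl

≡⇒∣X∣≤1 : ∀ {n} {X : Subset n} → (∀ {x y} → x ∈ X → y ∈ X → x ≡ y) → ∣ X ∣ ≤ 1
≡⇒∣X∣≤1 {X = X} all≡ = injective⇒≤ {f = λ _ → zero} λ {i} {j} _ →
  at-injective E (all≡ (at-satisfies E i) (at-satisfies E j))
  where E = enumerateSubset X refl

-- Codes of words and addition modulo `g`.

funToFin-cong : ∀ {m n} {f f′ : Fin m → Fin n} → f ≗ f′ → funToFin f ≡ funToFin f′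
funToFin-cong {zero}  eq = refl
funToFin-cong {suc m} eq = cong₂ combine (eq zero) (funToFin-cong (eq ∘ suc))

finToFun-injective : ∀ {m n} {a b : Fin (m ^ n)} → finToFun {m} {n} a ≗ finToFun b → a ≡ b
finToFun-injective {m} {n} {a} {b} eq = trans (sym (funToFin-finToFin {n} {m} a))
  (trans (funToFin-cong eq) (funToFin-finToFin {n} {m} b))

module _ {g : ℕ} .{{_ : NonZero g}} where

  private
    -- With `y` and `g ∸ y` as the two summands, in either order, this gives both cancellation laws
    -- below.
    mod-cancel : ∀ (x : Fin g) {b c} → b + c ≡ g → (toℕ ((toℕ x + b) mod g) + c) mod g ≡ x
    mod-cancel x {b} {c} b+c≡g = toℕ-injective (begin
      toℕ ((toℕ ((toℕ x + b) mod g) + c) mod g)   ≡⟨ toℕ-fromℕ< _ ⟩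
      (toℕ ((toℕ x + b) mod g) + c) % g           ≡⟨ cong (λ y → (y + c) % g) (toℕ-fromℕ< _) ⟩
      ((toℕ x + b) % g + c) % g                   ≡⟨ %-distribˡ-+ _ c g ⟩
      ((toℕ x + b) % g % g + c % g) % g           ≡⟨ cong (λ y → (y + c % g) % g) (m%n%n≡m%n (toℕ x + b) g) ⟩
      ((toℕ x + b) % g + c % g) % g               ≡⟨ %-distribˡ-+ (toℕ x + b) c g ⟨
      (toℕ x + b + c) % g                         ≡⟨ cong (_% g) (ℕ.+-assoc (toℕ x) b c) ⟩
      (toℕ x + (b + c)) % g                       ≡⟨ cong (λ y → (toℕ x + y) % g) b+c≡g ⟩
      (toℕ x + g) % g                             ≡⟨ [m+n]%n≡m%n (toℕ x) g ⟩
      toℕ x % g                                   ≡⟨ m<n⇒m%n≡m (toℕ<n x) ⟩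
      toℕ x                                       ∎)
      where open ≡-Reasoning

  infixl 6 _⊕_ _⊖_

  opaque

    _⊕_ _⊖_ : Fin g → Fin g → Fin g
    x ⊕ y = (toℕ x + toℕ y) mod g
    x ⊖ y = (toℕ x + (g ∸ toℕ y)) mod g

    ⊕-⊖-cancel : ∀ x y → x ⊕ y ⊖ y ≡ x
    ⊕-⊖-cancel x y = mod-cancel x (ℕ.m+[n∸m]≡n (ℕ.<⇒≤ (toℕ<n y)))

    ⊖-⊕-cancel : ∀ x y → x ⊖ y ⊕ y ≡ x
    ⊖-⊕-cancel x y = mod-cancel x (ℕ.m∸n+n≡m (ℕ.<⇒≤ (toℕ<n y)))

    ⊕-comm : ∀ x y → x ⊕ y ≡ y ⊕ x
    ⊕-comm x y = cong (_mod g) (ℕ.+-comm (toℕ x) (toℕ y))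

  ⊕-cancelˡ : ∀ x {y z} → x ⊕ y ≡ x ⊕ z → y ≡ z
  ⊕-cancelˡ x {y} {z} eq = begin
    y          ≡⟨ ⊕-⊖-cancel y x ⟨
    y ⊕ x ⊖ x  ≡⟨ cong (_⊖ x) (trans (⊕-comm y x) (trans eq (⊕-comm x z))) ⟩
    z ⊕ x ⊖ x  ≡⟨ ⊕-⊖-cancel z x ⟩
    z          ∎
    where open ≡-Reasoning

≗-++ : ∀ {A : Set} {m n} {f h : Fin (m + n) → A} →
       (∀ i → f (i ↑ˡ n) ≡ h (i ↑ˡ n)) → (∀ j → f (m ↑ʳ j) ≡ h (m ↑ʳ j)) → f ≗ h
≗-++ {m = m} {n} {f} {h} left right i with splitAt m i | Fin.join-splitAt m n i
... | inj₁ j | refl = left j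
... | inj₂ j | refl = right j

-- Translates of the orthogonal array.

module Translates {t d g} .{{_ : NonZero g}} (A : OA t (t + d) g) where

  open OA A

  origin : Fin g
  origin = 0 mod g

  -- The shift on the first `t` columns is the same for every `a`. Hence the first `t` letters of a
  -- word determine the row, and the other `d` letters then determine `a`.
  offset : Fin (g ^ d) → Fin (t + d) → Fin g
  offset a = (λ (_ : Fin t) → origin) ++ finToFun a

  word : Fin (g ^ d) → Fin (g ^ t) → Fin (t + d) → Fin g
  word a r j = matrix r j ⊕ offset a j

  -- A shift permutes the letters of each column, so finding `u` in the translate amounts to finding
  -- `u` shifted back in the original array.
  word-orthogonal : ∀ a (column : Fin t → Fin (t + d)) → Injective _≡_ _≡_ column →
                    ∀ (u : Fin t → Fin g) → ∃! _≡_ (λ r → ∀ j → word a r (column j) ≡ u j)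
  word-orthogonal a column inj u
    with orthogonal column inj (λ j → u j ⊖ offset a (column j))
  ... | r , row , unique =
    r ,
    (λ j → trans (cong (_⊕ offset a (column j)) (row j)) (⊖-⊕-cancel _ _)) ,
    λ row′ → unique λ j → trans (sym (⊕-⊖-cancel _ _)) (cong (_⊖ offset a (column j)) (row′ j))

  offset-head : ∀ a j → offset a (j ↑ˡ d) ≡ origin
  offset-head a j = lookup-++ˡ (λ (_ : Fin t) → origin) (finToFun a) j

  offset-tail : ∀ a j → offset a (t ↑ʳ j) ≡ finToFun a j
  offset-tail a j = lookup-++ʳ (λ (_ : Fin t) → origin) (finToFun a) j

  -- Orthogonality on the first `t` columns yields the row; `a` encodes the difference between `w`
  -- and that row on the last `d` columns.
  word-surjective : ∀ (w : Fin (t + d) → Fin g) → ∃₂ λ a r → word a r ≗ w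
  word-surjective w
    with orthogonal (_↑ˡ d) (↑ˡ-injective d _ _) (λ j → w (j ↑ˡ d) ⊖ origin)
  ... | r , row , _ = a , r , ≗-++ head tail
    where
    open ≡-Reasoning

    a = funToFin λ j → w (t ↑ʳ j) ⊖ matrix r (t ↑ʳ j)

    head : ∀ j → word a r (j ↑ˡ d) ≡ w (j ↑ˡ d)
    head j = begin
      matrix r (j ↑ˡ d) ⊕ offset a (j ↑ˡ d)  ≡⟨ cong₂ _⊕_ (row j) (offset-head a j) ⟩
      w (j ↑ˡ d) ⊖ origin ⊕ origin           ≡⟨ ⊖-⊕-cancel _ _ ⟩
      w (j ↑ˡ d)                             ∎

    tail : ∀ j → word a r (t ↑ʳ j) ≡ w (t ↑ʳ j)
    tail j = begin
      matrix r (t ↑ʳ j) ⊕ offset a (t ↑ʳ j)                 ≡⟨ cong (matrix r (t ↑ʳ j) ⊕_) (offset-tail a j) ⟩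
      matrix r (t ↑ʳ j) ⊕ finToFun a j                      ≡⟨ cong (matrix r (t ↑ʳ j) ⊕_) (finToFun-funToFin {d} _ j) ⟩
      matrix r (t ↑ʳ j) ⊕ (w (t ↑ʳ j) ⊖ matrix r (t ↑ʳ j))  ≡⟨ ⊕-comm (matrix r (t ↑ʳ j)) _ ⟩
      w (t ↑ʳ j) ⊖ matrix r (t ↑ʳ j) ⊕ matrix r (t ↑ʳ j)    ≡⟨ ⊖-⊕-cancel _ _ ⟩
      w (t ↑ʳ j)                                            ∎

  -- Agreement on the first `t` columns forces `r ≡ r′`; cancelling the common matrix entries on the
  -- last `d` columns leaves equal shifts.
  word-injective : ∀ {a r a′ r′} → word a r ≗ word a′ r′ → a ≡ a′
  word-injective {a} {r} {a′} {r′} eq = finToFun-injective λ j → begin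
    finToFun a j        ≡⟨ offset-tail a j ⟨
    offset a (t ↑ʳ j)   ≡⟨ ⊕-cancelˡ (matrix r (t ↑ʳ j)) (trans (eq (t ↑ʳ j)) (cong (λ r → word a′ r (t ↑ʳ j)) (sym r≡r′))) ⟩
    offset a′ (t ↑ʳ j)  ≡⟨ offset-tail a′ j ⟩
    finToFun a′ j       ∎
    where
    open ≡-Reasoning

    head : ∀ j → word a r (j ↑ˡ d) ≡ word a r′ (j ↑ˡ d)
    head j = begin
      word a r (j ↑ˡ d)    ≡⟨ eq (j ↑ˡ d) ⟩
      word a′ r′ (j ↑ˡ d)  ≡⟨ cong (matrix r′ (j ↑ˡ d) ⊕_) (trans (offset-head a′ j) (sym (offset-head a j))) ⟩
      word a r′ (j ↑ˡ d)   ∎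

    r≡r′ : r ≡ r′
    r≡r′ with word-orthogonal a (_↑ˡ d) (↑ˡ-injective d _ _) (λ j → word a r′ (j ↑ˡ d))
    ... | _ , _ , unique = trans (sym (unique head)) (unique λ _ → refl)

-- Points as pairs of a group and an entry; transversal sets as graphs of words.

module _ {n g : ℕ} where

  group-of : Fin (n * g) → Fin n
  group-of = quotient {n} g

  entry-of : Fin (n * g) → Fin g
  entry-of = remainder {n} g

  combine-group-entry : ∀ z → combine (group-of z) (entry-of z) ≡ z
  combine-group-entry = combine-remQuot {n} g

  standardGrouping : Grouping n g
  standardGrouping = record
    { group      = λ i → image (combine i)
    ; partition  = λ z → group-of z ,
        subst (_∈ image (combine (group-of z))) (combine-group-entry z) (∈-image⁺ {f = combine (group-of z)} (entry-of z)) ,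
        λ {i} z∈ → let b , eq = ∈-image⁻ {f = combine i} z∈ in
          combine-injectiveˡ _ _ _ _ (trans (combine-group-entry z) (sym eq))
    ; group-size = λ i → ∣image∣ {f = combine i} λ {b} {c} → combine-injectiveʳ i b i c
    }

  -- With its converse `transversal⁻`, this treats a transversal set as a partial function from
  -- groups to entries.
  transversal⁺ : ∀ {Y} → (∀ {i : Fin n} {b c : Fin g} → combine i b ∈ Y → combine i c ∈ Y → b ≡ c) →
                 Transversal standardGrouping Y
  transversal⁺ {Y} inj i = ≡⇒∣X∣≤1 λ y∈ z∈ → help (x∈p∩q⁻ Y _ y∈) (x∈p∩q⁻ Y _ z∈)
    where
    help : ∀ {y z} → y ∈ Y × y ∈ group standardGrouping i → z ∈ Y × z ∈ group standardGrouping i → y ≡ z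
    help (y∈Y , y∈G) (z∈Y , z∈G) with ∈-image⁻ {f = combine i} y∈G | ∈-image⁻ {f = combine i} z∈G
    ... | b , refl | c , refl = cong (combine i) (inj y∈Y z∈Y)

  transversal⁻ : ∀ {Y} → Transversal standardGrouping Y →
                 ∀ {i : Fin n} {b c : Fin g} → combine i b ∈ Y → combine i c ∈ Y → b ≡ c
  transversal⁻ {Y} tr {i} {b} {c} b∈ c∈ = combine-injectiveʳ i b i c
    (∣X∣≤1⇒≡ (tr i) (x∈p∩q⁺ (b∈ , ∈-image⁺ {f = combine i} b)) (x∈p∩q⁺ (c∈ , ∈-image⁺ {f = combine i} c)))

  record TransversalEnumeration (Y : Subset (n * g)) (m : ℕ) : Set where
    field
      support           : Fin m → Fin n
      value             : Fin m → Fin g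
      support-injective : Injective _≡_ _≡_ support
      point∈            : ∀ j → combine (support j) (value j) ∈ Y
      point-index       : ∀ {z} → z ∈ Y → ∃ λ j → combine (support j) (value j) ≡ z

  enumerateTransversal : ∀ {m} Y → ∣ Y ∣ ≡ m → Transversal standardGrouping Y → TransversalEnumeration Y m
  enumerateTransversal Y ∣Y∣≡m tr = record
    { support           = group-of ∘ at E
    ; value             = entry-of ∘ at E
    ; support-injective = λ {i} {j} eq → at-injective E (begin
        at E i                                           ≡⟨ combine-group-entry (at E i) ⟨
        combine (group-of (at E i)) (entry-of (at E i))  ≡⟨ cong₂ combine eq (transversal⁻ {Y} tr
                                                               (subst (λ x → combine x (entry-of (at E i)) ∈ Y) eq (point i)) (point j)) ⟩
        combine (group-of (at E j)) (entry-of (at E j))  ≡⟨ combine-group-entry (at E j) ⟩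
        at E j                                           ∎)
    ; point∈            = point
    ; point-index       = λ z∈ → let j , eq = index E z∈ in j , trans (combine-group-entry _) eq
    }
    where
    open ≡-Reasoning
    E = enumerateSubset Y ∣Y∣≡m

    point : ∀ j → combine (group-of (at E j)) (entry-of (at E j)) ∈ Y
    point j = subst (_∈ Y) (sym (combine-group-entry (at E j))) (at-satisfies E j)

  -- Like the columns of the array, w is indexed by positions in X.
  graph : ∀ {m} (X : Subset n) → ∣ X ∣ ≡ m → (Fin m → Fin g) → Subset (n * g)
  graph X p w = image λ j → combine (at (enumerateSubset X p) j) (w j)

  module _ {m} (X : Subset n) (p : ∣ X ∣ ≡ m) (w : Fin m → Fin g) where

    private E = enumerateSubset X p

    ∈-graph⁺ : ∀ j → combine (at E j) (w j) ∈ graph X p w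
    ∈-graph⁺ = ∈-image⁺ {f = λ j → combine (at E j) (w j)}

    ∈-graph⁻ : ∀ {x : Fin n} {b : Fin g} → combine x b ∈ graph X p w → ∃ λ j → at E j ≡ x × w j ≡ b
    ∈-graph⁻ z∈ with ∈-image⁻ {f = λ j → combine (at E j) (w j)} z∈
    ... | j , eq = j , combine-injective _ _ _ _ eq

    ∈-graph⇒∈ : ∀ {x : Fin n} {b : Fin g} → combine x b ∈ graph X p w → x ∈ X
    ∈-graph⇒∈ z∈ with ∈-graph⁻ z∈
    ... | j , refl , _ = at-satisfies E j

    ∈-graph⇒value : ∀ {j} {b : Fin g} → combine (at E j) b ∈ graph X p w → w j ≡ b
    ∈-graph⇒value z∈ with ∈-graph⁻ z∈
    ... | j , eq , value with at-injective E eq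
    ... | refl = value

    ∣graph∣ : ∣ graph X p w ∣ ≡ m
    ∣graph∣ = ∣image∣ {f = λ j → combine (at E j) (w j)}
      λ {i} {j} eq → at-injective E (combine-injectiveˡ _ (w i) _ (w j) eq)

    graph-transversal : Transversal standardGrouping (graph X p w)
    graph-transversal = transversal⁺ {graph X p w} help
      where
      help : ∀ {i : Fin n} {b c : Fin g} → combine i b ∈ graph X p w → combine i c ∈ graph X p w → b ≡ c
      help b∈ c∈ with ∈-graph⁻ b∈
      ... | j , refl , refl = ∈-graph⇒value c∈

  -- `X` is recovered as the set of groups that the graph meets, and each letter as the entry over
  -- the corresponding element of `X`.
  graph-injective : ∀ {m X X′} {p : ∣ X ∣ ≡ m} {p′ : ∣ X′ ∣ ≡ m} {w w′} →
                    graph X p w ≡ graph X′ p′ w′ → X ≡ X′ × w ≗ w′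
  graph-injective {m} {X} {X′} {p} {p′} {w} {w′} eq = X≡X′ , same-word X≡X′
    where
    support⊆ : ∀ X X′ (p : ∣ X ∣ ≡ m) (p′ : ∣ X′ ∣ ≡ m) w w′ → graph X p w ≡ graph X′ p′ w′ → X ⊆ X′
    support⊆ X X′ p p′ w w′ eq x∈X with index (enumerateSubset X p) x∈X
    ... | j , refl = ∈-graph⇒∈ X′ p′ w′ (⊆-reflexive eq (∈-graph⁺ X p w j))

    X≡X′ : X ≡ X′
    X≡X′ = ⊆-antisym (support⊆ X X′ p p′ w w′ eq) (support⊆ X′ X p′ p w′ w (sym eq))

    same-word : X ≡ X′ → w ≗ w′
    -- The enumeration of `X` takes the size proof as an argument, so the two proofs are identified
    -- before positions are compared.
    same-word refl j with ≡-irrelevant p p′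
    ... | refl = sym (∈-graph⇒value X p w′ (⊆-reflexive eq (∈-graph⁺ X p w j)))

  -- The equation is stated for every `w′` that agrees with `w` pointwise because `word-surjective`
  -- later supplies such a `w′`.
  transversal-graph : ∀ {m} Y → ∣ Y ∣ ≡ m → Transversal standardGrouping Y →
                      ∃ λ X → Σ (∣ X ∣ ≡ m) λ p → ∃ λ w → ∀ {w′} → w′ ≗ w → Y ≡ graph X p w′
  transversal-graph {m} Y ∣Y∣≡m tr = X , p , w , λ w′≗w → ⊆-antisym (below w′≗w) (above w′≗w)
    where
    open TransversalEnumeration (enumerateTransversal Y ∣Y∣≡m tr)
    X = image support
    p = ∣image∣ support-injective
    E = enumerateSubset X p

    -- `E` may list the groups in another order than `support` does; `position` translates between
    -- the two orders.
    position : Fin m → Fin m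
    position j = proj₁ (∈-image⁻ {f = support} (at-satisfies E j))

    at-position : ∀ j → support (position j) ≡ at E j
    at-position j = proj₂ (∈-image⁻ {f = support} (at-satisfies E j))

    w : Fin m → Fin g
    w j = value (position j)

    below : ∀ {w′} → w′ ≗ w → Y ⊆ graph X p w′
    below {w′} w′≗w z∈Y with point-index z∈Y
    ... | i , refl with index E (∈-image⁺ {f = support} i)
    ... | j , eq = subst (_∈ graph X p w′)
      (cong₂ combine eq (trans (w′≗w j) (cong value (support-injective (trans (at-position j) eq)))))
      (∈-graph⁺ X p w′ j)

    above : ∀ {w′} → w′ ≗ w → graph X p w′ ⊆ Y
    above {w′} w′≗w z∈ with ∈-image⁻ {f = λ j → combine (at E j) (w′ j)} z∈
    ... | j , refl = subst (_∈ Y) (cong₂ combine (at-position j) (sym (w′≗w j))) (point∈ (position j))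

-- The designs and their large set.

module Construction {n g t d} .{{_ : NonZero g}} (A : OA t (t + d) g) (L : LS t (t + d) n (g ^ d)) where

  open LS L
  open Translates A
  open SteinerSystem

  -- This list is the matching at `X`: the translate with code `a` belongs to the system in place
  -- `a`. The multiplicity `g ^ d` equals the number of translates.
  systemsAt : ∀ X → ∣ X ∣ ≡ t + d → Enumeration (λ i → Block (system i) X) (g ^ d)
  systemsAt X p = enumerateFilter (λ i → block? (system i) X) (multiplicity X p)

  -- The equation on `a` expresses the matching and, through `at-satisfies`, also makes `X` a block
  -- of `system i`.
  HBlock : Fin count → Pred (Subset (n * g)) 0ℓ
  HBlock i Y = ∃ λ X → Σ (∣ X ∣ ≡ t + d) λ p → ∃₂ λ a r →
               at (systemsAt X p) a ≡ i × Y ≡ graph X p (word a r)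

  hblock? : ∀ i → Decidable (HBlock i)
  hblock? i Y = anySubset? λ X → sized? X (∣ X ∣ ℕ.≟ t + d)
    where
    sized? : ∀ X → Dec (∣ X ∣ ≡ t + d) → Dec (Σ (∣ X ∣ ≡ t + d) λ p → ∃₂ λ a r →
             at (systemsAt X p) a ≡ i × Y ≡ graph X p (word a r))
    sized? X (no ¬p) = no (¬p ∘ proj₁)
    sized? X (yes p) = map′ (p ,_)
      -- The search runs over `a` and `r` with `p` fixed; a witness with another size proof is
      -- transported to `p`.
      (λ (p′ , rest) → subst (λ p → ∃₂ λ a r → at (systemsAt X p) a ≡ i × Y ≡ graph X p (word a r)) (≡-irrelevant p′ p) rest)
      (any? λ a → any? λ r → at (systemsAt X p) a Fin.≟ i ×-dec Vec.≡-dec Bool._≟_ Y (graph X p (word a r)))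

  -- The `t` groups met by `T` lie in one block `X` of `system i`, the matching at `X` fixes the
  -- translate, and orthogonality on the columns at those groups fixes the row.
  hblock-covers : ∀ i T → ∣ T ∣ ≡ t → Transversal standardGrouping T → ∃! _≡_ (λ Y → HBlock i Y × T ⊆ Y)
  hblock-covers i T ∣T∣≡t tr
    with covers (system i) (image (TransversalEnumeration.support (enumerateTransversal T ∣T∣≡t tr)))
           (∣image∣ (TransversalEnumeration.support-injective (enumerateTransversal T ∣T∣≡t tr)))
  ... | X , (bX , S⊆X) , X-unique = Y , ((X , p , a , r , a-system , refl) , T⊆Y) , λ (b , sub) → Y-unique b sub
    where
    open TransversalEnumeration (enumerateTransversal T ∣T∣≡t tr)
    p = block-size (system i) bX
    E = enumerateSubset X p
    a = proj₁ (index (systemsAt X p) bX)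
    a-system = proj₂ (index (systemsAt X p) bX)

    column : Fin t → Fin (t + d)
    column j = proj₁ (index E (S⊆X (∈-image⁺ {f = support} j)))

    at-column : ∀ j → at E (column j) ≡ support j
    at-column j = proj₂ (index E (S⊆X (∈-image⁺ {f = support} j)))

    column-injective : Injective _≡_ _≡_ column
    column-injective {j} {k} eq = support-injective
      (trans (sym (at-column j)) (trans (cong (at E) eq) (at-column k)))

    row = word-orthogonal a column column-injective value
    r = proj₁ row
    Y = graph X p (word a r)

    T⊆Y : T ⊆ Y
    T⊆Y z∈T with point-index z∈T
    ... | j , refl = subst (_∈ Y) (cong₂ combine (at-column j) (proj₁ (proj₂ row) j))
                       (∈-graph⁺ X p (word a r) (column j))

    Y-unique : ∀ {Y′} → HBlock i Y′ → T ⊆ Y′ → Y ≡ Y′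
    -- The data of a competing block are identified in turn: the support by the Steiner property,
    -- the translate by injectivity of the matching, the row by orthogonality.
    Y-unique (X′ , p′ , a′ , r′ , a′-system , refl) T⊆Y′
      with X-unique (subst (λ i → Block (system i) X′) a′-system (at-satisfies (systemsAt X′ p′) a′) , S⊆X′)
      where
      S⊆X′ : image support ⊆ X′
      S⊆X′ x∈ with ∈-image⁻ {f = support} x∈
      ... | j , refl = ∈-graph⇒∈ X′ p′ (word a′ r′) (T⊆Y′ (point∈ j))
    ... | refl with ≡-irrelevant p p′
    ... | refl with at-injective (systemsAt X p) (trans a-system (sym a′-system))
    ... | refl = cong (graph X p ∘ word a) (proj₂ (proj₂ row) λ j → ∈-graph⇒value X p (word a r′)
                   (subst (λ x → combine x (value j) ∈ graph X p (word a r′)) (sym (at-column j)) (T⊆Y′ (point∈ j))))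

  hdesign : Fin count → HDesign {n} {g} standardGrouping (t + d) t
  hdesign i = record
    { Block             = HBlock i
    ; block?            = hblock? i
    ; block-size        = λ { (X , p , a , r , _ , refl) → ∣graph∣ X p (word a r) }
    ; block-transversal = λ { (X , p , a , r , _ , refl) → graph-transversal X p (word a r) }
    ; covers            = hblock-covers i
    }

  -- Since `t ≤ n` there is a `t`-subset of the points, and the block of `system i` through it
  -- carries the required graphs.
  hblock-nonempty : t ≤ n → ∀ i → Satisfiable (HBlock i)
  hblock-nonempty t≤n i
    with covers (system i) (image λ j → inject≤ j t≤n) (∣image∣ λ {j} {k} → inject≤-injective t≤n t≤n j k)
  ... | X , (bX , _) , _ with index (systemsAt X (block-size (system i) bX)) bX
  -- Any row would do; the code of a constant word is an explicit element of `Fin (g ^ t)`.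
  ... | a , a-system = _ , X , _ , a , funToFin (λ (_ : Fin t) → origin) , a-system , refl

  -- `Y` determines its support `X` and its word, the word lies in exactly one translate, and the
  -- matching at `X` sends that translate to one system.
  hblock-partition : ∀ Y → ∣ Y ∣ ≡ t + d → Transversal standardGrouping Y → ∃! _≡_ (λ i → HBlock i Y)
  hblock-partition Y ∣Y∣≡k tr = at (systemsAt X p) a , (X , p , a , r , refl , Y≡graph) , unique
    where
    representation = transversal-graph Y ∣Y∣≡k tr
    X = proj₁ representation
    p = proj₁ (proj₂ representation)
    surjective = word-surjective (proj₁ (proj₂ (proj₂ representation)))
    a = proj₁ surjective
    r = proj₁ (proj₂ surjective)

    Y≡graph : Y ≡ graph X p (word a r)
    Y≡graph = proj₂ (proj₂ (proj₂ representation)) (proj₂ (proj₂ surjective))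

    unique : ∀ {i} → HBlock i Y → at (systemsAt X p) a ≡ i
    unique (X′ , p′ , a′ , r′ , refl , eq) = same-system (graph-injective {X = X} {X′} {p} {p′} (trans (sym Y≡graph) eq))
      where
      same-system : X ≡ X′ × word a r ≗ word a′ r′ → at (systemsAt X p) a ≡ at (systemsAt X′ p′) a′
      same-system (refl , w≗w′) with ≡-irrelevant p p′
      ... | refl = cong (at (systemsAt X p)) (word-injective w≗w′)

  largeSet : t ≤ n → LH n g (t + d) t
  largeSet t≤n = record
    { grouping  = standardGrouping
    ; count     = count
    ; design    = hdesign
    ; nonempty  = hblock-nonempty t≤n
    ; partition = hblock-partition
    }

-- For n < t the Steiner systems may have no blocks, and then the designs built
-- from them would be empty parts.
emptyLargeSet : ∀ {n g k t} → n < k → LH n g k t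
emptyLargeSet {n} {g} n<k = record
  { grouping  = standardGrouping {n} {g}
  ; count     = 0
  ; design    = λ ()
  ; nonempty  = λ ()
  ; partition = λ Y ∣Y∣≡k tr → contradiction
      (injective⇒≤ (TransversalEnumeration.support-injective (enumerateTransversal Y ∣Y∣≡k tr))) (ℕ.<⇒≱ n<k)
  }

theorem5 : ∀ (n g k t : ℕ)
    .{{_ : NonZero n}} .{{_ : NonZero g}} .{{_ : NonZero k}} .{{_ : NonZero t}} →
    t ≤ k → OA t k g → LS t k n (g ^ (k ∸ t)) → LH n g k t
theorem5 n g k t t≤k A L with ℕ.m≤n⇒∃[o]m+o≡n t≤k
-- Writing `k` as `t + d` splits the columns into the first `t` and the `d` that get shifted.
... | d , refl with t ℕ.≤? n
... | yes t≤n = Construction.largeSet A (subst (λ e → LS t (t + d) n (g ^ e)) (ℕ.m+n∸m≡n t d) L) t≤n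
... | no  t≰n = emptyLargeSet (ℕ.<-≤-trans (ℕ.≰⇒> t≰n) t≤k)
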